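{- For every integer $n\ge 1$, the $n$th record-length run of zeros in the sequence $B$ has length $A(n)$ and is run number $D(n-1)$ among all runs of zeros of $B$. In particular, $A(n)=R(D(n-1))$.
   Context: The sequence $A$ (OEIS A000975: $1,2,5,10,21,42,85,\dots$) is defined by $A(1)=1$, $A(2m)=2A(2m-1)$ and $A(2m+1)=2A(2m)+1$ for $m\ge 1$. The sequence $B$ (OEIS A265158) is defined on positive integers by $B(1)=1$, and for $n\ge 1$, $B(2n)=2B(n)$ and $B(2n+1)=\lfloor B(n)/2\rfloor$. A run of zeros in $B$ is a maximal (nonempty) block of consecutive indices $n$ with $B(n)=0$; its length is the number of indices in it. The runs of zeros are numbered $1,2,3,\dots$ in the order in which they occur, and $R(j)$ denotes the length of run number $j$ (OEIS A264784: $1,2,5,10,1,21,2,42,1,1,5,1,85,\dots$). A run of zeros is of record length if it is strictly longer than every run of zeros occurring earlier (the first run counts as a record). $C(i)=\binom{2i}{i}/(i+1)$ denotes the $i$th Catalan number. $D$ denotes the sequence OEIS A155051, indexed from $0$, given by $D(m)=\sum_{i=0}^{m} C(\lfloor i/2\rfloor)$, i.e. the partial sums of $C(0),C(0),C(1),C(1),C(2),C(2),\dots$; it begins $D(0)=1$, $2,3,4,6,8,13,18,\dots$. -}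

module Defs where

open import Data.Nat using (ℕ; zero; suc; _+_; _*_; _∸_; _≤_; _<_; z≤n; s≤s; z<s; _/_; _%_; ⌊_/2⌋; _≟_)
open import Data.Nat.Properties
open import Data.Nat.DivMod using (m*n%n≡0; [m+kn]%n≡m%n)
open import Data.Nat.Combinatorics using (_C_)
open import Data.Nat.Induction using (<-rec; <-wellFounded)
open import Data.Product using (∃; ∃-syntax; _×_; _,_; proj₁; proj₂)
open import Data.Sum using (inj₁; inj₂)
open import Induction.WellFounded using (module FixPoint)
open import Relation.Binary.Definitions using (tri<; tri≈; tri>)
open import Relation.Binary.PropositionalEquality
open import Relation.Nullary using (¬_; yes; no; contradiction; ¬?)
open import Relation.Unary using (Decidable)

-- All sequences except D are indexed from 1; their value at 0 is a dummy and
-- is never used as a term of the sequence.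

A : ℕ → ℕ
A zero    = 0
A (suc n) = 2 * A n + suc n % 2

A-one : A 1 ≡ 1
A-one = refl

A-even : ∀ m → 1 ≤ m → A (2 * m) ≡ 2 * A (2 * m ∸ 1)
A-even (suc m) _ = begin
  2 * A k + suc k % 2          ≡⟨ cong (λ x → 2 * A k + x % 2) (*-comm 2 (suc m)) ⟩
  2 * A k + (suc m * 2) % 2    ≡⟨ cong (2 * A k +_) (m*n%n≡0 (suc m) 2) ⟩
  2 * A k + 0                  ≡⟨ +-identityʳ _ ⟩
  2 * A k                      ∎
  where
  open ≡-Reasoning
  k : ℕ
  k = 2 * suc m ∸ 1

A-odd : ∀ m → A (suc (2 * m)) ≡ 2 * A (2 * m) + 1
A-odd m = cong (2 * A (2 * m) +_)
  (trans (cong (λ x → suc x % 2) (*-comm 2 m)) ([m+kn]%n≡m%n 1 m 2))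

B-combine : (parity b : ℕ) → ℕ
B-combine zero    b = 2 * b
B-combine (suc _) b = ⌊ b /2⌋

B-step : ∀ n → (∀ {m} → m < n → ℕ) → ℕ
B-step zero            _   = 0
B-step (suc zero)      _   = 1
B-step n@(suc (suc k)) rec = B-combine (n % 2) (rec {⌊ n /2⌋} (⌊n/2⌋<n (suc k)))

B : ℕ → ℕ
B = <-rec (λ _ → ℕ) B-step

private
  B-step-ext : ∀ n {f g : ∀ {m} → m < n → ℕ} →
               (∀ {m} (p : m < n) → f p ≡ g p) → B-step n f ≡ B-step n g
  B-step-ext zero            _  = refl
  B-step-ext (suc zero)      _  = refl
  B-step-ext n@(suc (suc k)) eq = cong (B-combine (n % 2)) (eq (⌊n/2⌋<n (suc k)))

  B-unfold : ∀ k → B (2 + k) ≡ B-combine ((2 + k) % 2) (B ⌊ 2 + k /2⌋)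
  B-unfold k = FixPoint.unfold-wfRec <-wellFounded (λ _ → ℕ) B-step B-step-ext {2 + k}

  ⌊2n/2⌋ : ∀ n → ⌊ 2 * n /2⌋ ≡ n
  ⌊2n/2⌋ n = trans (cong (λ x → ⌊ n + x /2⌋) (+-identityʳ n)) (sym (n≡⌊n+n/2⌋ n))

  ⌊1+2n/2⌋ : ∀ n → ⌊ suc (2 * n) /2⌋ ≡ n
  ⌊1+2n/2⌋ zero    = refl
  ⌊1+2n/2⌋ (suc n) = trans (cong (λ x → ⌊ suc x /2⌋) (*-suc 2 n)) (cong suc (⌊1+2n/2⌋ n))

  B-unfold′ : ∀ m → 2 ≤ m → B m ≡ B-combine (m % 2) (B ⌊ m /2⌋)
  B-unfold′ (suc (suc k)) _ = B-unfold k
  B-unfold′ (suc zero) (s≤s ())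

B-one : B 1 ≡ 1
B-one = refl

B-even : ∀ n → 1 ≤ n → B (2 * n) ≡ 2 * B n
B-even n 1≤n = trans (B-unfold′ (2 * n) (*-monoʳ-≤ 2 1≤n))
  (cong₂ B-combine (trans (cong (_% 2) (*-comm 2 n)) (m*n%n≡0 n 2)) (cong B (⌊2n/2⌋ n)))

B-odd : ∀ n → 1 ≤ n → B (suc (2 * n)) ≡ ⌊ B n /2⌋
B-odd n 1≤n = trans (B-unfold′ (suc (2 * n)) (m≤n⇒m≤1+n (*-monoʳ-≤ 2 1≤n)))
  (cong₂ B-combine (trans (cong (λ x → suc x % 2) (*-comm 2 n)) ([m+kn]%n≡m%n 1 n 2))
                   (cong B (⌊1+2n/2⌋ n)))

Catalan : ℕ → ℕ
Catalan i = ((2 * i) C i) / suc i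

D : ℕ → ℕ
D zero    = Catalan ⌊ 0 /2⌋
D (suc m) = D m + Catalan ⌊ suc m /2⌋

-- Nth P n k: the positive integer k is the n-th smallest positive integer
-- satisfying P (n ≥ 1).
data Nth (P : ℕ → Set) : ℕ → ℕ → Set where
  first : ∀ {k} → 1 ≤ k → P k → (∀ i → 1 ≤ i → i < k → ¬ P i) → Nth P 1 k
  next  : ∀ {n j k} → Nth P n j → j < k → P k →
          (∀ i → j < i → i < k → ¬ P i) → Nth P (suc n) k

private
  firstAbove-unique : ∀ {P : ℕ → Set} {j k k′} →
    j < k  → P k  → (∀ i → j < i → i < k  → ¬ P i) →
    j < k′ → P k′ → (∀ i → j < i → i < k′ → ¬ P i) → k ≡ k′
  firstAbove-unique {k = k} {k′} a p m a′ p′ m′ with <-cmp k k′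
  ... | tri< k<k′ _ _ = contradiction p (m′ k a k<k′)
  ... | tri≈ _ k≡k′ _ = k≡k′
  ... | tri> _ _ k′<k = contradiction p′ (m k′ a′ k′<k)

  Nth-zero : ∀ {P k} → ¬ Nth P 0 k
  Nth-zero ()

Nth-unique : ∀ {P n k k′} → Nth P n k → Nth P n k′ → k ≡ k′
Nth-unique (first a p m) (first a′ p′ m′) = firstAbove-unique a p m a′ p′ m′
Nth-unique (first _ _ _) (next x _ _ _) = contradiction x Nth-zero
Nth-unique (next x _ _ _) (first _ _ _) = contradiction x Nth-zero
Nth-unique (next x a p m) (next x′ a′ p′ m′) with refl ← Nth-unique x x′ =
  firstAbove-unique a p m a′ p′ m′

-- The nonempty block of indices s, s + 1, …, s + ℓ − 1.
record ZeroBlock (s ℓ : ℕ) : Set where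
  field
    start-positive  : 1 ≤ s
    length-positive : 1 ≤ ℓ
    zeros           : ∀ i → s ≤ i → i < s + ℓ → B i ≡ 0

record IsRun (s ℓ : ℕ) : Set where
  field
    block   : ZeroBlock s ℓ
    maximal : ∀ s′ ℓ′ → ZeroBlock s′ ℓ′ → s′ ≤ s → s + ℓ ≤ s′ + ℓ′ →
              s′ ≡ s × ℓ′ ≡ ℓ
  open ZeroBlock block public

IsRunStart : ℕ → Set
IsRunStart s = ∃[ ℓ ] IsRun s ℓ

-- Runs are numbered by their starting indices: run number j is the run
-- starting at s.
RunNumber : (j s : ℕ) → Set
RunNumber = Nth IsRunStart

-- R is a total function because both zeros and nonzero values of B occur
-- beyond every index; the construction below finds the runs by search.

private
  zeroBeyond : ∀ n → ∃[ m ] (n ≤ m × B m ≡ 0)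
  zeroBeyond n = let m , _ , n≤m , e = go n in m , n≤m , e
    where
    go : ∀ n → ∃[ m ] (1 ≤ m × n ≤ m × B m ≡ 0)
    go zero    = 3 , s≤s z≤n , z≤n , refl
    go (suc n) with m , 1≤m , n≤m , e ← go n =
      suc (2 * m) , s≤s z≤n , s≤s (≤-trans n≤m (m≤m+n m _)) ,
      trans (B-odd m 1≤m) (cong ⌊_/2⌋ e)

  nonzeroBeyond : ∀ n → ∃[ m ] (n ≤ m × B m ≢ 0)
  nonzeroBeyond n = let m , _ , n≤m , e = go n in m , n≤m , e
    where
    go : ∀ n → ∃[ m ] (1 ≤ m × n ≤ m × B m ≢ 0)
    go zero    = 1 , s≤s z≤n , z≤n , λ ()
    go (suc n) with m , 1≤m , n≤m , e ← go n =
      2 * m , ≤-trans 1≤m (m≤m+n m _) ,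
      ≤-trans (+-mono-≤ 1≤m n≤m) (+-monoʳ-≤ m (m≤m+n m 0)) ,
      λ z → e (m+n≡0⇒m≡0 (B m) (trans (sym (B-even m 1≤m)) z))

  leastFrom : ∀ {P : ℕ → Set} → Decidable P → ∀ n → ∃[ m ] (n ≤ m × P m) →
              ∃[ m ] (n ≤ m × P m × (∀ i → n ≤ i → i < m → ¬ P i))
  leastFrom {P} P? n (m , n≤m , Pm) = go (m ∸ n) n (m+[n∸m]≡n n≤m)
    where
    go : ∀ d n → n + d ≡ m → ∃[ k ] (n ≤ k × P k × (∀ i → n ≤ i → i < k → ¬ P i))
    go d n e with P? n
    ... | yes p = n , ≤-refl , p , λ i n≤i i<n → contradiction n≤i (<⇒≱ i<n)
    go zero n e | no ¬p = contradiction (subst P (trans (sym e) (+-identityʳ n)) Pm) ¬p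
    go (suc d) n e | no ¬p with k , n<k , p , least ← go d (suc n) (trans (sym (+-suc n d)) e) =
      k , <⇒≤ n<k , p , λ i n≤i i<k → case-≤ i n≤i i<k least
      where
      case-≤ : ∀ i → n ≤ i → i < k → (∀ i → suc n ≤ i → i < k → ¬ P i) → ¬ P i
      case-≤ i n≤i i<k least with m≤n⇒m<n∨m≡n n≤i
      ... | inj₁ n<i  = least i n<i i<k
      ... | inj₂ refl = ¬p

-- A zero block bounded by nonzero terms is a run, and conversely.
isRun : ∀ {p ℓ} → ZeroBlock (suc p) ℓ → B p ≢ 0 → B (suc p + ℓ) ≢ 0 → IsRun (suc p) ℓ
isRun {p} {ℓ} b left right = record { block = b ; maximal = maximal }
  where
  maximal : ∀ s′ ℓ′ → ZeroBlock s′ ℓ′ → s′ ≤ suc p → suc p + ℓ ≤ s′ + ℓ′ →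
            s′ ≡ suc p × ℓ′ ≡ ℓ
  maximal s′ ℓ′ b′ s′≤ ≤e with m≤n⇒m<n∨m≡n s′≤
  ... | inj₁ (s≤s s′≤p) = contradiction
    (ZeroBlock.zeros b′ p s′≤p (≤-trans (m≤m+n (suc p) ℓ) ≤e)) left
  ... | inj₂ refl with m≤n⇒m<n∨m≡n ≤e
  ...   | inj₁ e<  = contradiction (ZeroBlock.zeros b′ (suc p + ℓ) (m≤m+n (suc p) ℓ) e<) right
  ...   | inj₂ e≡  = refl , sym (+-cancelˡ-≡ (suc p) _ _ e≡)

run-left : ∀ {p ℓ} → IsRun (suc p) ℓ → 1 ≤ p → B p ≢ 0
run-left {p} {ℓ} r 1≤p Bp≡0 =
  1+n≢n (sym (proj₁ (IsRun.maximal r p (suc ℓ) bigger (n≤1+n p) (≤-reflexive (sym (+-suc p ℓ))))))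
  where
  bigger : ZeroBlock p (suc ℓ)
  bigger = record
    { start-positive  = 1≤p
    ; length-positive = s≤s z≤n
    ; zeros = λ i p≤i i< → zeros i i< (m≤n⇒m<n∨m≡n p≤i)
    }
    where
    zeros : ∀ i → i < p + suc ℓ → _ → B i ≡ 0
    zeros i i< (inj₁ p<i)  = IsRun.zeros r i p<i (subst (i <_) (+-suc p ℓ) i<)
    zeros i i< (inj₂ refl) = Bp≡0

run-right : ∀ {s ℓ} → IsRun s ℓ → B (s + ℓ) ≢ 0
run-right {s} {ℓ} r Be≡0 =
  1+n≢n (proj₂ (IsRun.maximal r s (suc ℓ) bigger ≤-refl (+-monoʳ-≤ s (n≤1+n ℓ))))
  where
  bigger : ZeroBlock s (suc ℓ)
  bigger = record
    { start-positive  = IsRun.start-positive r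
    ; length-positive = s≤s z≤n
    ; zeros = λ i s≤i i< →
        zeros i s≤i (m≤n⇒m<n∨m≡n (m<1+n⇒m≤n (subst (i <_) (+-suc s ℓ) i<)))
    }
    where
    zeros : ∀ i → s ≤ i → _ → B i ≡ 0
    zeros i s≤i (inj₁ i<e)  = IsRun.zeros r i s≤i i<e
    zeros i s≤i (inj₂ refl) = Be≡0

private
  start-nonzero : ∀ {s} → IsRunStart s → B s ≢ 0 → ∀ {X : Set} → X
  start-nonzero {s} (ℓ , r) ≢0 = contradiction
    (IsRun.zeros r s ≤-refl
      (≤-trans (≤-reflexive (+-comm 1 s)) (+-monoʳ-≤ s (IsRun.length-positive r))))
    ≢0

  -- The first run after a nonzero term.
  nextRun : ∀ n → B n ≢ 0 →
            ∃[ s ] (n < s × IsRunStart s × (∀ i → n ≤ i → i < s → B i ≢ 0))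
  nextRun n Bn≢0 with leastFrom (λ i → B i ≟ 0) n (zeroBeyond n)
  ... | s , n≤s , Bs≡0 , nz with m≤n⇒m<n∨m≡n n≤s
  ...   | inj₂ refl = contradiction Bs≡0 Bn≢0
  ...   | inj₁ n<s@(s≤s {n = p} n≤p)
    with e , s≤e , Be≢0 , z ← leastFrom (λ i → ¬? (B i ≟ 0)) s (nonzeroBeyond s)
    = s , n<s , (e ∸ s , isRun b (nz p n≤p ≤-refl) (subst (λ x → B x ≢ 0) (sym eq) Be≢0)) , nz
    where
    eq : s + (e ∸ s) ≡ e
    eq = m+[n∸m]≡n s≤e
    s<e : s < e
    s<e = ≤∧≢⇒< s≤e λ { refl → Be≢0 Bs≡0 }
    b : ZeroBlock s (e ∸ s)
    b = record
      { start-positive  = s≤s z≤n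
      ; length-positive = m<n⇒0<n∸m s<e
      ; zeros = λ i s≤i i< → zeros i s≤i (subst (i <_) eq i<)
      }
      where
      zeros : ∀ i → s ≤ i → i < e → B i ≡ 0
      zeros i s≤i i<e with B i ≟ 0
      ... | yes q = q
      ... | no ¬q = contradiction ¬q (z i s≤i i<e)

run : ∀ j → ∃[ s ] ∃[ ℓ ] (RunNumber (suc j) s × IsRun s ℓ)
run zero with s , 1<s , (ℓ , r) , nz ← nextRun 1 (λ ()) =
  s , ℓ , first (<⇒≤ 1<s) (ℓ , r) (λ i 1≤i i<s st → start-nonzero st (nz i 1≤i i<s)) , r
run (suc j) with s , ℓ , num , r ← run j
            with s′ , e<s′ , (ℓ′ , r′) , nz ← nextRun (s + ℓ) (run-right r) =
  s′ , ℓ′ , next num (≤-trans (s≤s (m≤m+n s ℓ)) e<s′) (ℓ′ , r′) none , r′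
  where
  none : ∀ i → s < i → i < s′ → ¬ IsRunStart i
  none (suc p) (s≤s s≤p) i<s′ st@(_ , ri) with suc p <? s + ℓ
  ... | yes i<e = run-left ri (≤-trans (IsRun.start-positive r) s≤p)
                    (IsRun.zeros r p s≤p (<⇒≤ i<e))
  ... | no i≮e  = start-nonzero st (nz (suc p) (≮⇒≥ i≮e) i<s′)

R : ℕ → ℕ
R zero    = 0
R (suc j) = proj₁ (proj₂ (run j))

R-spec : ∀ j → 1 ≤ j → ∃[ s ] (RunNumber j s × IsRun s (R j))
R-spec (suc j) _ = let s , _ , num , r = run j in s , num , r

IsRun-length-unique : ∀ {s ℓ ℓ′} → IsRun s ℓ → IsRun s ℓ′ → ℓ ≡ ℓ′
IsRun-length-unique {s} {ℓ} {ℓ′} r r′ with ≤-total ℓ ℓ′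
... | inj₁ ℓ≤ℓ′ = sym (proj₂ (IsRun.maximal r s ℓ′ (IsRun.block r′) ≤-refl (+-monoʳ-≤ s ℓ≤ℓ′)))
... | inj₂ ℓ′≤ℓ = proj₂ (IsRun.maximal r′ s ℓ (IsRun.block r) ≤-refl (+-monoʳ-≤ s ℓ′≤ℓ))

R-unique : ∀ {j s ℓ} → 1 ≤ j → RunNumber j s → IsRun s ℓ → R j ≡ ℓ
R-unique {j} 1≤j num r with s′ , num′ , r′ ← R-spec j 1≤j
  with refl ← Nth-unique num num′ = IsRun-length-unique r′ r

-- Runs are identified with their (positive) run numbers.
IsRecord : ℕ → Set
IsRecord j = ∀ i → 1 ≤ i → i < j → R i < R j

{-# OPTIONS --safe #-}
module Submission where

-- Every nonzero value of B is a power of 2, and a node n with B n = 2 ^ e has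
-- children 2n, 2n + 1 with exponents e + 1, e − 1, a child of negative exponent
-- being 0 together with all its descendants. So level k, the indices in
-- [2 ^ k, 2 ^ (k + 1)), begins with a nonzero term and ends in zeros: its last
-- run has length A k, because A k = 2 ^ (k − 1) + A (k − 2), and induction on
-- the level bounds its other runs by A (k − 1). Hence exactly the last runs of
-- the levels k ≥ 1 are records. The number of runs on a level obeys the
-- recurrence of ±1 paths killed on leaving the nonnegative exponents, and the
-- reflection principle evaluates it at the root as a Catalan number.

open import Defs
open import Data.Nat using (ℕ; zero; suc; _+_; _*_; _∸_; _^_; _/_; _%_; _≤_; _<_; _<?_; z≤n; s≤s; ⌊_/2⌋)
open import Data.Nat.Properties
open import Data.Nat.DivMod using (m*n/n≡m)
open import Data.Nat.Combinatorics using (_C_; nC1≡n; nCk≡nC[n∸k]; nCk+nC[k+1]≡[n+1]C[k+1])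
open import Data.Nat.Tactic.RingSolver using (solve-∀)
open import Data.List.Base using (List; []; _∷_; _++_; length)
open import Data.List.Properties using (length-++; ++-assoc)
open import Data.List.Relation.Unary.All using (All; []; _∷_)
import Data.List.Relation.Unary.All as All
open import Data.List.Relation.Unary.All.Properties using (++⁺)
open import Data.Product using (∃-syntax; _×_; _,_; proj₁; proj₂)
open import Data.Sum using (inj₁; inj₂)
open import Relation.Binary.PropositionalEquality
open import Relation.Nullary using (¬_; yes; no; contradiction)

-- Counting elements of a predicate

-- `Nth` stores only the hits; storing the misses too lets a count advance index by index, without
-- deciding `P`.
data CountUpTo (P : ℕ → Set) : ℕ → ℕ → Set where
  base : CountUpTo P 0 0
  hit  : ∀ {j a} → CountUpTo P j a → P (suc a) → CountUpTo P (suc j) (suc a)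
  miss : ∀ {j a} → CountUpTo P j a → ¬ P (suc a) → CountUpTo P j (suc a)

nthAfter : ∀ {P j a k} → CountUpTo P j a → a < k → P k →
           (∀ i → a < i → i < k → ¬ P i) → Nth P (suc j) k
nthAfter base 0<k p none = first 0<k p none
nthAfter (hit c q) a<k p none =
  next (nthAfter c ≤-refl q λ i a<i i≤a → contradiction i≤a (≤⇒≯ a<i)) a<k p none
nthAfter {P} {k = k} (miss {a = a} c ¬q) a<k p none = nthAfter c (<⇒≤ a<k) p none′
  where
  none′ : ∀ i → a < i → i < k → ¬ P i
  none′ i a<i i<k with m≤n⇒m<n∨m≡n a<i
  ... | inj₁ sa<i = none i sa<i i<k
  ... | inj₂ refl = ¬q

nthSuc : ∀ {P j a} → CountUpTo P j a → P (suc a) → Nth P (suc j) (suc a)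
nthSuc c p = nthAfter c ≤-refl p λ i a<i i≤a → contradiction i≤a (≤⇒≯ a<i)

misses : ∀ {P j a} m → CountUpTo P j a → (∀ i → a < i → i ≤ a + m → ¬ P i) →
         CountUpTo P j (a + m)
misses {P} {j} {a} zero c none = subst (CountUpTo P j) (sym (+-identityʳ a)) c
misses {P} {j} {a} (suc m) c none =
  subst (CountUpTo P j) (sym (+-suc a m))
    (miss (misses m c λ i a<i i≤ → none i a<i (≤-trans i≤ (+-monoʳ-≤ a (n≤1+n m))))
          (none (suc (a + m)) (s≤s (m≤m+n a m)) (≤-reflexive (sym (+-suc a m)))))

-- Zeros of B

IsRunStart⇒B≡0 : ∀ {s} → IsRunStart s → B s ≡ 0
IsRunStart⇒B≡0 {s} (_ , r) = IsRun.zeros r s ≤-refl (m<m+n s (IsRun.length-positive r))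

2*n*2^d : ∀ n d → 2 * n * 2 ^ d ≡ n * 2 ^ suc d
2*n*2^d n d = lemma n (2 ^ d)
  where
  lemma : ∀ n p → 2 * n * p ≡ n * (2 * p)
  lemma = solve-∀

[1+2n]*2^d+2^d : ∀ n d → suc (2 * n) * 2 ^ d + 2 ^ d ≡ suc n * 2 ^ suc d
[1+2n]*2^d+2^d n d = lemma n (2 ^ d)
  where
  lemma : ∀ n p → suc (2 * n) * p + p ≡ suc n * (2 * p)
  lemma = solve-∀

-- The depth-`d` descendants of `n` fill `[n * 2 ^ d, suc n * 2 ^ d)`. Both children of a zero are
-- zero, and their descendants split this interval at `suc (2 * n) * 2 ^ d`.
zeroDescendants : ∀ d {n} → 1 ≤ n → B n ≡ 0 →
                  ∀ i → n * 2 ^ d ≤ i → i < suc n * 2 ^ d → B i ≡ 0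
zeroDescendants zero {n} 1≤n Bn≡0 i ≤i i<
  with refl ← ≤-antisym (subst (_≤ i) (*-identityʳ n) ≤i)
                        (m<1+n⇒m≤n (subst (i <_) (*-identityʳ (suc n)) i<)) = Bn≡0
zeroDescendants (suc d) {n} 1≤n Bn≡0 i ≤i i< with i <? suc (2 * n) * 2 ^ d
... | yes i<mid = zeroDescendants d (≤-trans 1≤n (m≤m+n n _))
        (trans (B-even n 1≤n) (cong (2 *_) Bn≡0))
        i (subst (_≤ i) (sym (2*n*2^d n d)) ≤i) i<mid
... | no i≮mid = zeroDescendants d {suc (2 * n)} (s≤s z≤n)
        (trans (B-odd n 1≤n) (cong ⌊_/2⌋ Bn≡0))
        i (≮⇒≥ i≮mid)
        (subst (i <_) (trans (sym ([1+2n]*2^d+2^d n d)) (+-comm _ (2 ^ d))) i<)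

2^n≢0 : ∀ n → 2 ^ n ≢ 0
2^n≢0 n eq = 1+n≢0 (n≤0⇒n≡0 (subst (1 ≤_) eq (m^n>0 2 n)))

-- Along the leftmost branch the value only doubles, so it never vanishes; such terms separate the
-- subtrees of nonzero nodes.
B-*2^≢0 : ∀ d {n} → 1 ≤ n → B n ≢ 0 → B (n * 2 ^ d) ≢ 0
B-*2^≢0 zero {n} 1≤n Bn≢0 B≡0 = Bn≢0 (trans (cong B (sym (*-identityʳ n))) B≡0)
B-*2^≢0 (suc d) {n} 1≤n Bn≢0 B≡0 = B-*2^≢0 d (≤-trans 1≤n (m≤m+n n _))
  (λ B2n≡0 → Bn≢0 (m+n≡0⇒m≡0 (B n) (trans (sym (B-even n 1≤n)) B2n≡0)))
  (trans (cong B (2*n*2^d n d)) B≡0)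

B-2^≢0 : ∀ k → B (2 ^ k) ≢ 0
B-2^≢0 k = subst (λ x → B x ≢ 0) (*-identityˡ (2 ^ k)) (B-*2^≢0 k {1} (s≤s z≤n) λ ())

⌊2*n/2⌋≡n : ∀ n → ⌊ 2 * n /2⌋ ≡ n
⌊2*n/2⌋≡n n = trans (cong (λ x → ⌊ n + x /2⌋) (+-identityʳ n)) (sym (n≡⌊n+n/2⌋ n))

-- The sequence A

A-suc-suc : ∀ n → A (2 + n) ≡ A n + 2 ^ suc n
A-suc-suc zero    = refl
A-suc-suc (suc n) = begin
  2 * A (2 + n) + r               ≡⟨ cong (λ x → 2 * x + r) (A-suc-suc n) ⟩
  2 * (A n + 2 ^ suc n) + r       ≡⟨ lemma (A n) (2 ^ suc n) r ⟩
  2 * A n + r + 2 * 2 ^ suc n     ∎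
  where
  open ≡-Reasoning
  r : ℕ
  r = suc n % 2
  lemma : ∀ a p r → 2 * (a + p) + r ≡ 2 * a + r + 2 * p
  lemma = solve-∀

-- This is how zeros add up below a node of value 1: those ending its left half and the `2 ^ n` of
-- its right half. At `n = 0` it relies on `A 0 ≡ 0`.
A-suc : ∀ n → A (suc n) ≡ A (n ∸ 1) + 2 ^ n
A-suc zero    = refl
A-suc (suc n) = A-suc-suc n

A-positive : ∀ n → 1 ≤ A (suc n)
A-positive n = ≤-trans (m^n>0 2 n) (≤-trans (m≤n+m _ _) (≤-reflexive (sym (A-suc n))))

A-< : ∀ n → A n < A (suc n)
A-< zero    = s≤s z≤n
A-< (suc n) = ≤-trans
  (+-mono-≤ (A-positive n) (≤-reflexive (sym (+-identityʳ (A (suc n))))))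
  (m≤m+n (2 * A (suc n)) _)

A-mono : ∀ {m n} → m ≤ n → A m ≤ A n
A-mono {n = zero} z≤n = ≤-refl
A-mono {n = suc n} m≤ with m≤n⇒m<n∨m≡n m≤
... | inj₁ (s≤s m≤n) = ≤-trans (A-mono m≤n) (<⇒≤ (A-< n))
... | inj₂ refl      = ≤-refl

-- Runs of zeros below a node

-- Runs a b xs: the runs starting in (a, b] have lengths xs, provided B a ≢ 0.
data Runs : ℕ → ℕ → List ℕ → Set where
  done : ∀ {a} → Runs a a []
  skip : ∀ {a b xs} → B (suc a) ≢ 0 → Runs (suc a) b xs → Runs a b xs
  zeros : ∀ {a b ℓ xs} → ZeroBlock (suc a) ℓ → B (suc a + ℓ) ≢ 0 →
          Runs (suc a + ℓ) b xs → Runs a b (ℓ ∷ xs)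

_++ᴿ_ : ∀ {a b c xs ys} → Runs a b xs → Runs b c ys → Runs a c (xs ++ ys)
done         ++ᴿ s = s
skip nz r    ++ᴿ s = skip nz (r ++ᴿ s)
zeros z nz r ++ᴿ s = zeros z nz (r ++ᴿ s)

-- An empty stretch of zeros is no run, hence the empty list rather than a run of length 0.
block : ℕ → List ℕ
block zero    = []
block (suc n) = suc n ∷ []

blockRun : ∀ a z → (∀ i → a < i → i < suc a + z → B i ≡ 0) → B (suc a + z) ≢ 0 →
           Runs a (suc a + z) (block z)
blockRun a zero zs nz rewrite +-identityʳ a = skip nz done
blockRun a (suc z) zs nz =
  zeros (record { start-positive = s≤s z≤n ; length-positive = s≤s z≤n ; zeros = zs }) nz done

-- The depth-d descendants of a node n with B n = 2 ^ e end in A (d ∸ e) zeros;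
-- innerRuns e d lists the lengths of the runs before these.
innerRuns : (e d : ℕ) → List ℕ
innerRuns e       zero    = []
innerRuns zero    (suc d) = innerRuns 1 d
innerRuns (suc e) (suc d) = innerRuns (2 + e) d ++ block (A (d ∸ (2 + e))) ++ innerRuns e d

-- The z zeros following the descendants lengthen their last run: this lets the
-- induction pass through nodes of value 1, whose right half is all zeros.
descendantRuns : ∀ d {e n} z → 1 ≤ n → B n ≡ 2 ^ e →
  (∀ i → suc n * 2 ^ d ≤ i → i < suc n * 2 ^ d + z → B i ≡ 0) →
  B (suc n * 2 ^ d + z) ≢ 0 →
  Runs (n * 2 ^ d) (suc n * 2 ^ d + z) (innerRuns e d ++ block (A (d ∸ e) + z))
descendantRuns zero {e} {n} z 1≤n Bn zs nz
  rewrite *-identityʳ n | 0∸n≡0 e = blockRun n z zs nz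
descendantRuns (suc d) {zero} {n} z 1≤n Bn zs nz =
  subst₂ (λ a b → Runs a b (innerRuns 1 d ++ block (A (suc d) + z))) (2*n*2^d n d) end
    (subst (λ t → Runs (2 * n * 2 ^ d) (mid + (2 ^ d + z)) (innerRuns 1 d ++ block t)) tail
      -- The right child is zero, so its `2 ^ d` descendants join the `z` zeros behind the left
      -- half.
      (descendantRuns d (2 ^ d + z) (≤-trans 1≤n (m≤m+n n _))
        (trans (B-even n 1≤n) (cong (2 *_) Bn)) zs′ (subst (λ x → B x ≢ 0) (sym end) nz)))
  where
  mid : ℕ
  mid = suc (2 * n) * 2 ^ d
  end : mid + (2 ^ d + z) ≡ suc n * 2 ^ suc d + z
  end = trans (sym (+-assoc mid (2 ^ d) z)) (cong (_+ z) ([1+2n]*2^d+2^d n d))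
  tail : A (d ∸ 1) + (2 ^ d + z) ≡ A (suc d) + z
  tail = trans (sym (+-assoc (A (d ∸ 1)) (2 ^ d) z)) (cong (_+ z) (sym (A-suc d)))
  zs′ : ∀ i → mid ≤ i → i < mid + (2 ^ d + z) → B i ≡ 0
  zs′ i mid≤i i< with i <? suc n * 2 ^ suc d
  ... | no i≮  = zs i (≮⇒≥ i≮) (subst (i <_) end i<)
  ... | yes i<′ = zeroDescendants d {suc (2 * n)} (s≤s z≤n) (trans (B-odd n 1≤n) (cong ⌊_/2⌋ Bn)) i mid≤i
          (subst (i <_) (trans (sym ([1+2n]*2^d+2^d n d)) (+-comm _ (2 ^ d))) i<′)
descendantRuns (suc d) {suc e} {n} z 1≤n Bn zs nz =
  subst₂ (Runs (n * 2 ^ suc d)) end lists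
    -- Here `mid` is the leftmost descendant of `2n + 1` and nonzero, so the last run of the left
    -- half stops there: `z = 0` on the left, while the right half inherits `z`.
    (subst₂ (λ a b → Runs a b (innerRuns (2 + e) d ++ block (A (d ∸ (2 + e)) + 0)))
        (2*n*2^d n d) (+-identityʳ mid)
        (descendantRuns d 0 (≤-trans 1≤n (m≤m+n n _))
          (trans (B-even n 1≤n) (cong (2 *_) Bn))
          (λ i ≤i i< → contradiction ≤i (<⇒≱ (subst (i <_) (+-identityʳ mid) i<)))
          (subst (λ x → B x ≢ 0) (sym (+-identityʳ mid))
            (B-*2^≢0 d {suc (2 * n)} (s≤s z≤n) λ B≡0 → 2^n≢0 e (trans (sym Bodd) B≡0))))
     ++ᴿ descendantRuns d {e} {suc (2 * n)} z (s≤s z≤n) Bodd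
          (λ i ≤i i< → zs i (subst (_≤ i) end′ ≤i) (subst (i <_) end i<))
          (subst (λ x → B x ≢ 0) (sym end) nz))
  where
  mid : ℕ
  mid = suc (2 * n) * 2 ^ d
  Bodd : B (suc (2 * n)) ≡ 2 ^ e
  Bodd = trans (B-odd n 1≤n) (trans (cong ⌊_/2⌋ Bn) (⌊2*n/2⌋≡n (2 ^ e)))
  end′ : (2 + 2 * n) * 2 ^ d ≡ suc n * 2 ^ suc d
  end′ = trans (+-comm (2 ^ d) mid) ([1+2n]*2^d+2^d n d)
  end : (2 + 2 * n) * 2 ^ d + z ≡ suc n * 2 ^ suc d + z
  end = cong (_+ z) end′
  lists : (innerRuns (2 + e) d ++ block (A (d ∸ (2 + e)) + 0)) ++
          (innerRuns e d ++ block (A (d ∸ e) + z))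
        ≡ innerRuns (suc e) (suc d) ++ block (A (d ∸ e) + z)
  lists rewrite +-identityʳ (A (d ∸ (2 + e)))
    | ++-assoc (innerRuns (2 + e) d) (block (A (d ∸ (2 + e)))) (innerRuns e d ++ block (A (d ∸ e) + z))
    | ++-assoc (innerRuns (2 + e) d) (block (A (d ∸ (2 + e))) ++ innerRuns e d) (block (A (d ∸ e) + z))
    | ++-assoc (block (A (d ∸ (2 + e)))) (innerRuns e d) (block (A (d ∸ e) + z)) = refl

-- Level `k` consists of the depth-`k` descendants of the root, where `B 1 = 2 ^ 0`; the next level
-- starts with a nonzero term, hence `z = 0`.
levelRuns : ∀ k → Runs (2 ^ k) (2 ^ suc k) (innerRuns 0 k ++ block (A k))
levelRuns k = subst₂ (λ a t → Runs a (2 ^ suc k) (innerRuns 0 k ++ block t))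
    (+-identityʳ (2 ^ k)) (+-identityʳ (A k))
    (subst (λ b → Runs (1 * 2 ^ k) b (innerRuns 0 k ++ block (A k + 0))) (+-identityʳ (2 ^ suc k))
      (descendantRuns k {0} {1} 0 (s≤s z≤n) refl
        (λ i ≤i i< → contradiction ≤i (<⇒≱ (subst (i <_) (+-identityʳ (2 ^ suc k)) i<)))
        (subst (λ x → B x ≢ 0) (sym (+-identityʳ (2 ^ suc k))) (B-2^≢0 (suc k)))))

-- Induction bounds the runs inside the halves. The run ending a left half, now inner, comes from a
-- child of larger exponent, so `A` is taken at no larger an argument. For `e = 0` the bound is the
-- last run of the previous level.
innerRuns-bounded : ∀ e d → All (_≤ A (d ∸ suc e)) (innerRuns e d)
innerRuns-bounded e zero = []
innerRuns-bounded zero (suc d) =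
  All.map (λ x≤ → ≤-trans x≤ (A-mono (m∸n≤m d 2))) (innerRuns-bounded 1 d)
innerRuns-bounded (suc e) (suc d) =
  ++⁺ (All.map (λ x≤ → ≤-trans x≤ (A-mono (∸-monoʳ-≤ d (m≤n+m (suc e) 2))))
               (innerRuns-bounded (2 + e) d))
  (++⁺ (block-bounded (A-mono (∸-monoʳ-≤ d (n≤1+n (suc e)))))
       (innerRuns-bounded e d))
  where
  block-bounded : ∀ {m n} → m ≤ n → All (_≤ n) (block m)
  block-bounded {zero}  _   = []
  block-bounded {suc _} m≤n = m≤n ∷ []

-- The number of runs on a level

-- The number of paths with steps ±1 from suc e to 0 that first meet 0 at the
-- end and have u up-steps.
ballot : (e u : ℕ) → ℕ
ballot e       zero    = 1
ballot zero    (suc u) = ballot 1 u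
ballot (suc e) (suc u) = ballot (2 + e) u + ballot e (suc u)

-- An exponent drops by at most one per level, so a node of exponent `e` has no zero descendant down
-- to depth `e`.
innerRuns-empty : ∀ {e d} → d ≤ e → innerRuns e d ≡ []
innerRuns-left-empty : ∀ {e d} → d ≤ 2 + e → innerRuns (suc e) (suc d) ≡ innerRuns e d

innerRuns-empty {d = zero} _ = refl
innerRuns-empty {suc e} {suc d} (s≤s d≤e) =
  trans (innerRuns-left-empty (≤-trans d≤e (m≤n+m e 2))) (innerRuns-empty d≤e)

innerRuns-left-empty {e} d≤
  rewrite innerRuns-empty {2 + e} d≤ | m≤n⇒m∸n≡0 d≤ = refl

length-block : ∀ {n} → 1 ≤ n → length (block n) ≡ 1
length-block (s≤s _) = refl

-- The `suc` counts the last run. A path from `suc e` to 0 with `u` up-steps has `e + 1 + 2u` steps,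
-- so depth `e + 1 + j` has room for `⌊ j /2⌋` up-steps; both sides obey the same recurrence.
length-innerRuns : ∀ e j → suc (length (innerRuns e (e + suc j))) ≡ ballot e ⌊ j /2⌋
length-innerRuns zero zero          = refl
length-innerRuns zero (suc zero)    = refl
length-innerRuns zero (suc (suc j)) = length-innerRuns 1 j
length-innerRuns (suc e) zero =
  trans (cong (λ xs → suc (length xs)) (innerRuns-left-empty (≤-trans (≤-reflexive (+-comm e 1)) (n≤1+n (suc e)))))
        (length-innerRuns e zero)
length-innerRuns (suc e) (suc zero) =
  trans (cong (λ xs → suc (length xs)) (innerRuns-left-empty (≤-reflexive (+-comm e 2))))
        (length-innerRuns e (suc zero))
length-innerRuns (suc e) (suc (suc j)) = begin
  suc (length (x ++ b ++ y))                ≡⟨ cong suc (length-++ x) ⟩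
  suc (length x + length (b ++ y))          ≡⟨ cong (λ t → suc (length x + t)) (length-++ b) ⟩
  suc (length x + (length b + length y))    ≡⟨ cong (λ t → suc (length x + (t + length y))) length-b ⟩
  suc (length x) + suc (length y)           ≡⟨ cong₂ _+_ length-x (length-innerRuns e (suc (suc j))) ⟩
  ballot (2 + e) ⌊ j /2⌋ + ballot e (suc ⌊ j /2⌋) ∎
  where
  open ≡-Reasoning
  d : ℕ
  d = e + (3 + j)
  x y b : List ℕ
  x = innerRuns (2 + e) d
  b = block (A (d ∸ (2 + e)))
  y = innerRuns e d
  d≡ : d ≡ 2 + e + suc j
  d≡ = lemma e j
    where
    lemma : ∀ e j → e + (3 + j) ≡ 2 + e + suc j
    lemma = solve-∀
  -- The depth exceeds the exponent of the left child, so its half does end in a run, which supplies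
  -- the `suc` of the left count.
  length-b : length b ≡ 1
  length-b = trans
    (cong (λ t → length (block (A t))) (trans (cong (_∸ (2 + e)) d≡) (m+n∸m≡n (2 + e) (suc j))))
    (length-block (A-positive j))
  length-x : suc (length x) ≡ ballot (2 + e) ⌊ j /2⌋
  length-x = trans (cong (λ t → suc (length (innerRuns (2 + e) t))) d≡)
                   (length-innerRuns (2 + e) j)

-- Binomial coefficients and the reflection principle

pascal : ∀ n k → suc n C suc k ≡ n C k + n C suc k
pascal n k = sym (nCk+nC[k+1]≡[n+1]C[k+1] n k)

absorption : ∀ n k → suc k * (suc n C suc k) ≡ suc n * (n C k)
absorption zero zero       = refl
absorption zero (suc k)    = *-zeroʳ (2 + k)
absorption (suc n) zero    = trans (*-identityˡ _) (trans (nC1≡n (2 + n)) (sym (*-identityʳ (2 + n))))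
absorption (suc n) (suc k) = begin
  (2 + k) * ((2 + n) C (2 + k))                    ≡⟨ cong ((2 + k) *_) (pascal (suc n) (suc k)) ⟩
  (2 + k) * (p + suc n C (2 + k))                    ≡⟨ lemma₁ (suc k) p (suc n C (2 + k)) ⟩
  p + suc k * p + (2 + k) * (suc n C (2 + k))        ≡⟨ cong₂ (λ s t → p + s + t) (absorption n k) (absorption n (suc k)) ⟩
  p + suc n * (n C k) + suc n * (n C suc k)        ≡⟨ lemma₂ (suc n) p (n C k) (n C suc k) ⟩
  p + suc n * (n C k + n C suc k)                  ≡⟨ cong (λ t → p + suc n * t) (sym (pascal n k)) ⟩
  (2 + n) * p                                      ∎
  where
  open ≡-Reasoning
  p : ℕ
  p = suc n C suc k
  lemma₁ : ∀ k p q → suc k * (p + q) ≡ p + k * p + suc k * q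
  lemma₁ = solve-∀
  lemma₂ : ∀ n p a b → p + n * a + n * b ≡ p + n * (a + b)
  lemma₂ = solve-∀

infixl 6.5 _C⁻_
-- The coefficient one place to the left, with 0 beyond the edge, so that Pascal's rule and the
-- reflection formula also cover `k = 0`.
_C⁻_ : ℕ → ℕ → ℕ
n C⁻ zero  = 0
n C⁻ suc k = n C k

pascal⁻ : ∀ n k → suc n C k ≡ n C⁻ k + n C k
pascal⁻ n zero    = refl
pascal⁻ n (suc k) = pascal n k

central : ∀ u → suc (2 * u) C suc u ≡ suc (2 * u) C u
central u = trans (nCk≡nC[n∸k] (s≤s (m≤m+n u _)))
  (cong (suc (2 * u) C_) (trans (m+n∸m≡n u (u + 0)) (+-identityʳ u)))

-- The reflection principle, moved to avoid truncated subtraction.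
ballot-reflection : ∀ e u → ballot e u + (2 * u + e) C⁻ u ≡ (2 * u + e) C u
ballot-reflection e zero = refl
ballot-reflection zero (suc u) = subst
  (λ m → ballot 1 u + m C u ≡ m C suc u) (sym (trans (+-identityʳ (2 * suc u)) (*-suc 2 u))) (begin
  ballot 1 u + suc n C u                ≡⟨ cong (ballot 1 u +_) (pascal⁻ n u) ⟩
  ballot 1 u + (n C⁻ u + n C u)         ≡⟨ sym (+-assoc (ballot 1 u) _ _) ⟩
  ballot 1 u + n C⁻ u + n C u           ≡⟨ cong (_+ n C u) reflect ⟩
  -- On the boundary the recurrence has a single term; symmetry of the odd row turns the reflected
  -- coefficient into the one that Pascal's rule needs.
  n C u + n C u                         ≡⟨ cong (n C u +_) (sym (central u)) ⟩
  n C u + n C suc u                     ≡⟨ sym (pascal n u) ⟩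
  suc n C suc u                         ∎)
  where
  open ≡-Reasoning
  n : ℕ
  n = suc (2 * u)
  reflect : ballot 1 u + n C⁻ u ≡ n C u
  reflect = subst (λ m → ballot 1 u + m C⁻ u ≡ m C u) (+-comm (2 * u) 1) (ballot-reflection 1 u)
ballot-reflection (suc e) (suc u) = subst
  (λ m → ballot (2 + e) u + ballot e (suc u) + m C u ≡ m C suc u)
  (sym (+-suc (2 * suc u) e)) (begin
  a + b + suc n C u                 ≡⟨ cong (a + b +_) (pascal⁻ n u) ⟩
  a + b + (n C⁻ u + n C u)          ≡⟨ interchange a b (n C⁻ u) (n C u) ⟩
  (a + n C⁻ u) + (b + n C u)        ≡⟨ cong₂ _+_ reflect (ballot-reflection e (suc u)) ⟩
  n C u + n C suc u                 ≡⟨ sym (pascal n u) ⟩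
  suc n C suc u                     ∎)
  where
  open ≡-Reasoning
  n a b : ℕ
  n = 2 * suc u + e
  a = ballot (2 + e) u
  b = ballot e (suc u)
  interchange : ∀ a b c d → a + b + (c + d) ≡ (a + c) + (b + d)
  interchange = solve-∀
  n≡ : 2 * u + (2 + e) ≡ n
  n≡ = lemma u e
    where
    lemma : ∀ u e → 2 * u + (2 + e) ≡ 2 * suc u + e
    lemma = solve-∀
  reflect : a + n C⁻ u ≡ n C u
  reflect = subst (λ m → a + m C⁻ u ≡ m C u) n≡ (ballot-reflection (2 + e) u)

-- For `suc u`, reflection gives `g + q = p` for neighbouring coefficients, whose ratio `p : q` is
-- `(u + 2) : (u + 1)` by absorption; eliminating `q` leaves `(u + 2) g = p`.
ballot-0-* : ∀ u → ballot 0 u * suc u ≡ (2 * u) C u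
ballot-0-* zero    = refl
ballot-0-* (suc u) = +-cancelʳ-≡ (suc u * p) _ _ (begin
  g * (2 + u) + suc u * p       ≡⟨ cong (g * (2 + u) +_) balance ⟩
  g * (2 + u) + (2 + u) * q     ≡⟨ lemma₁ u g q ⟩
  (2 + u) * (g + q)             ≡⟨ cong ((2 + u) *_) reflect ⟩
  p + suc u * p                 ∎)
  where
  open ≡-Reasoning
  n g p q : ℕ
  n = 2 * suc u
  g = ballot 0 (suc u)
  p = n C suc u
  q = n C u
  lemma₁ : ∀ u g q → g * (2 + u) + (2 + u) * q ≡ (2 + u) * (g + q)
  lemma₁ = solve-∀
  reflect : g + q ≡ p
  reflect = subst (λ m → g + m C u ≡ m C suc u) (+-identityʳ n) (ballot-reflection 0 (suc u))
  balance : suc u * p ≡ (2 + u) * q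
  balance = +-cancelˡ-≡ (suc u * q) _ _ (begin
    suc u * q + suc u * p       ≡⟨ sym (*-distribˡ-+ (suc u) q p) ⟩
    suc u * (q + p)             ≡⟨ cong (suc u *_) (sym (pascal n u)) ⟩
    suc u * (suc n C suc u)     ≡⟨ absorption n u ⟩
    suc n * q                   ≡⟨ lemma₂ u q ⟩
    suc u * q + (2 + u) * q     ∎)
    where
    lemma₂ : ∀ u q → suc (2 * suc u) * q ≡ suc u * q + (2 + u) * q
    lemma₂ = solve-∀

ballot-Catalan : ∀ u → ballot 0 u ≡ Catalan u
ballot-Catalan u = trans (sym (m*n/n≡m (ballot 0 u) (suc u))) (cong (_/ suc u) (ballot-0-* u))

-- Enumeration of the runs

data Values (f : ℕ → ℕ) : ℕ → List ℕ → Set where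
  []  : ∀ {j} → Values f j []
  _∷_ : ∀ {j x xs} → f (suc j) ≡ x → Values f (suc j) xs → Values f j (x ∷ xs)

Values-++⁻ : ∀ {f j} xs {ys} → Values f j (xs ++ ys) →
             Values f j xs × Values f (j + length xs) ys
Values-++⁻ {f} {j} [] {ys} vs = [] , subst (λ t → Values f t ys) (sym (+-identityʳ j)) vs
Values-++⁻ {f} {j} (x ∷ xs) {ys} (v ∷ vs) with us , ws ← Values-++⁻ xs vs =
  v ∷ us , subst (λ t → Values f t ys) (sym (+-suc j (length xs))) ws

-- Each block begins right after a nonzero term and ends before another, which makes it maximal; the
-- count gives its run number, and `R-unique` then identifies its length.
enumerate : ∀ {j a b xs} → 1 ≤ a → B a ≢ 0 → CountUpTo IsRunStart j a → Runs a b xs →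
            Values R j xs × CountUpTo IsRunStart (j + length xs) b
enumerate {j} {a} _ _ c done = [] , subst (λ t → CountUpTo IsRunStart t a) (sym (+-identityʳ j)) c
enumerate 1≤a _ c (skip nz r) =
  enumerate (s≤s z≤n) nz (miss c λ st → nz (IsRunStart⇒B≡0 st)) r
enumerate {j} {a} {b} 1≤a Ba≢0 c (zeros {ℓ = ℓ} {xs} z nz r) =
  R-unique (s≤s z≤n) (nthSuc c (ℓ , thisRun)) thisRun ∷ proj₁ rest ,
  subst (λ t → CountUpTo IsRunStart t b) (sym (+-suc j (length xs))) (proj₂ rest)
  where
  thisRun : IsRun (suc a) ℓ
  thisRun = isRun z Ba≢0 nz
  -- Up to and including the nonzero terminator, every such index follows a zero, and no run starts
  -- right after a zero.
  interior : ∀ i → suc a < i → i ≤ suc a + ℓ → ¬ IsRunStart i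
  interior (suc p) (s≤s a<p) p< (_ , r′) =
    run-left r′ (≤-trans (s≤s z≤n) a<p) (ZeroBlock.zeros z p a<p p<)
  rest : Values R (suc j) xs × CountUpTo IsRunStart (suc j + length xs) b
  rest = enumerate (s≤s z≤n) nz (misses ℓ (hit c (ℓ , thisRun)) interior) r

-- Records

noRecords : ∀ {n j xs} → CountUpTo IsRecord n j → Values R j xs →
            All (λ x → ∃[ i ] (1 ≤ i × i ≤ j × x ≤ R i)) xs →
            CountUpTo IsRecord n (j + length xs)
noRecords {n} {j} c [] [] = subst (CountUpTo IsRecord n) (sym (+-identityʳ j)) c
noRecords {n} {j} {_ ∷ xs} c (refl ∷ vs) ((i , 1≤i , i≤j , x≤) ∷ ds) =
  subst (CountUpTo IsRecord n) (sym (+-suc j (length xs)))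
    (noRecords (miss c λ rec → <⇒≱ (rec i 1≤i (s≤s i≤j)) x≤) vs
      (All.map (λ (i , 1≤i , i≤j , x≤) → i , 1≤i , m≤n⇒m≤1+n i≤j , x≤) ds))

BoundedUpTo : (f : ℕ → ℕ) (j M : ℕ) → Set
BoundedUpTo f j M = ∀ i → 1 ≤ i → i ≤ j → f i ≤ M

BoundedUpTo-suc : ∀ {f j M} → BoundedUpTo f j M → f (suc j) ≤ M → BoundedUpTo f (suc j) M
BoundedUpTo-suc bd le i 1≤i i≤ with m≤n⇒m<n∨m≡n i≤
... | inj₁ (s≤s i≤j) = bd i 1≤i i≤j
... | inj₂ refl      = le

BoundedUpTo-++ : ∀ {f j M xs} → BoundedUpTo f j M → Values f j xs → All (_≤ M) xs →
                 BoundedUpTo f (j + length xs) M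
BoundedUpTo-++ {f} {j} {M} bd [] [] = subst (λ t → BoundedUpTo f t M) (sym (+-identityʳ j)) bd
BoundedUpTo-++ {f} {j} {M} {_ ∷ xs} bd (refl ∷ vs) (le ∷ les) =
  subst (λ t → BoundedUpTo f t M) (sym (+-suc j (length xs)))
    (BoundedUpTo-++ (BoundedUpTo-suc bd le) vs les)

-- The situation after levels 0, …, k, which contain m runs.
record State (k m : ℕ) : Set where
  field
    runs      : CountUpTo IsRunStart m (2 ^ suc k)
    records   : CountUpTo IsRecord k m
    bounded   : BoundedUpTo R m (A k)
    dominated : All (λ x → ∃[ i ] (1 ≤ i × i ≤ m × x ≤ R i)) (innerRuns 0 (suc k))

initialState : State 0 0
initialState = record
  { runs      = miss (miss base (λ st → contradiction (IsRunStart⇒B≡0 st) λ ()))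
                     (λ st → contradiction (IsRunStart⇒B≡0 st) λ ())
  ; records   = base
  ; bounded   = λ { (suc _) _ () }
  ; dominated = []
  }

advance : ∀ {k m} → State k m → let m′ = suc (m + length (innerRuns 0 (suc k))) in
          State (suc k) m′ × Nth IsRecord (suc k) m′ × R m′ ≡ A (suc k)
advance {k} {m} st = record
    { runs      = subst (λ t → CountUpTo IsRunStart t (2 ^ (2 + k))) m+length (proj₂ level)
    ; records   = hit noneInside isRecord
    ; bounded   = BoundedUpTo-suc
                    (λ i 1≤i i≤ → ≤-trans (boundedInside i 1≤i i≤) (<⇒≤ (A-< k)))
                    (≤-reflexive R-last)
    -- The run just found attains the bound `A (suc k)` on the inner runs of the following level, so
    -- it is the witness for all of them.
    ; dominated = All.map
                    (λ x≤ → _ , s≤s z≤n , ≤-refl , ≤-trans x≤ (≤-reflexive (sym R-last)))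
                    (innerRuns-bounded 0 (2 + k))
    } , nthSuc noneInside isRecord , R-last
  where
  open State st
  inner : List ℕ
  inner = innerRuns 0 (suc k)
  level : Values R m (inner ++ block (A (suc k))) ×
          CountUpTo IsRunStart (m + length (inner ++ block (A (suc k)))) (2 ^ (2 + k))
  level = enumerate (m^n>0 2 (suc k)) (B-2^≢0 (suc k)) runs (levelRuns (suc k))
  m+length : m + length (inner ++ block (A (suc k))) ≡ suc (m + length inner)
  m+length = begin
    m + length (inner ++ block (A (suc k)))         ≡⟨ cong (m +_) (length-++ inner) ⟩
    m + (length inner + length (block (A (suc k)))) ≡⟨ cong (λ t → m + (length inner + t)) (length-block (A-positive k)) ⟩
    m + (length inner + 1)                          ≡⟨ cong (m +_) (+-comm (length inner) 1) ⟩
    m + suc (length inner)                          ≡⟨ +-suc m (length inner) ⟩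
    suc (m + length inner)                          ∎
    where open ≡-Reasoning
  values : Values R m inner × Values R (m + length inner) (block (A (suc k)))
  values = Values-++⁻ inner (proj₁ level)
  block-value : ∀ {f j n} → 1 ≤ n → Values f j (block n) → f (suc j) ≡ n
  block-value (s≤s _) (v ∷ []) = v
  R-last : R (suc (m + length inner)) ≡ A (suc k)
  R-last = block-value (A-positive k) (proj₂ values)
  noneInside : CountUpTo IsRecord k (m + length inner)
  noneInside = noRecords records (proj₁ values) dominated
  boundedInside : BoundedUpTo R (m + length inner) (A k)
  boundedInside = BoundedUpTo-++ bounded (proj₁ values) (innerRuns-bounded 0 (suc k))
  isRecord : IsRecord (suc (m + length inner))
  isRecord i 1≤i (s≤s i≤) =
    <-≤-trans (s≤s (boundedInside i 1≤i i≤)) (≤-trans (A-< k) (≤-reflexive (sym R-last)))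

-- `D k` counts the runs through level `k + 1`; level `k + 2` adds `ballot 0 ⌊ suc k /2⌋`, a Catalan
-- number.
D-suc : ∀ k → suc (D k + length (innerRuns 0 (2 + k))) ≡ D (suc k)
D-suc k = trans (sym (+-suc (D k) _))
  (cong (D k +_) (trans (length-innerRuns 0 (suc k)) (ballot-Catalan ⌊ suc k /2⌋)))

levelState : ∀ k → State (suc k) (D k) × Nth IsRecord (suc k) (D k) × R (D k) ≡ A (suc k)
-- Levels 0 and 1 hold the single run at index 3, and `D 0` computes to 1.
levelState zero    = advance initialState
levelState (suc k) =
  subst (λ m → State (2 + k) m × Nth IsRecord (2 + k) m × R m ≡ A (2 + k)) (D-suc k)
    (advance (proj₁ (levelState k)))

theorem4p7 : ∀ (n : ℕ) → 1 ≤ n →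
    (∃[ j ] (Nth IsRecord n j × R j ≡ A n × j ≡ D (n ∸ 1)))
    × A n ≡ R (D (n ∸ 1))
theorem4p7 (suc k) _ with _ , nth , eq ← levelState k =
  (D k , nth , eq , refl) , sym eq
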